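{- Let $C_1=(v_1,h_1),\ C_2=(v_2,h_2)\in F$ and let $t=t(C_1,C_2)=[p_1,p_2,p_3,p_4]\in L^4$ be the corresponding quadruple. The following are equivalent: \begin{itemize} \item $(F,+,*)$ is a presemifield, where $x*y=T\big((C_1y^{\sigma}+C_2\overline{y}^{\sigma})x\big)+T(xy)z$; \item $T(C_1x\overline{x}^{\sigma}+C_2x^{\sigma+1})\neq 0$ for all $0\neq x\in F$; \item the polynomial $P_{C_1,C_2,s}(X)=C_2X^{\sigma+1}+\overline{C_1}X^{\sigma}+C_1X+\overline{C_2}\in F[X]$ has no root of norm $1$, i.e. no root $X\in F$ with $N(X)=1$; \item the polynomial $p_{s,t}(X)=p_1X^{\sigma+1}+p_2X^{\sigma}+p_3X+p_4\in L[X]$ has no root in $L$. \end{itemize}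
   Context: Let $m\ge 1$, $F=GF(2^{2m})\supset L=GF(2^m)$, $\overline{x}=x^{2^m}$ for $x\in F$, and let $T(x)=x+\overline{x}$, $N(x)=x\overline{x}$ be the trace and norm from $F$ to $L$. Fix $\mu\in L$ of absolute trace $1$ and $z\in F$ with $z^2+z=\mu$; then $1,z$ is a basis of $F$ over $L$ and we write $(a,b)=a+bz$ for $a,b\in L$. Let $0\le s<2m$ be an integer and $\sigma=2^s$, so $x^{\sigma}=x^{2^s}$. Put $\mu_s=\sum_{i=0}^{s-1}\mu^{2^i}$ (so $\mu_0=0$). For $C_1=(v_1,h_1)$, $C_2=(v_2,h_2)\in F$ the corresponding quadruple $t=t(C_1,C_2)=[p_1,p_2,p_3,p_4]\in L^4$ is given by $p_1=h_1+h_2$, $p_2=v_1+v_2+h_1+h_2$, $p_3=v_1+v_2+\mu_sh_1+(\mu_s+1)h_2$, $p_4=\mu_sv_1+(\mu_s+1)v_2+(\mu_s+\mu)h_1+(\mu_s+\mu+1)h_2$. A (finite) presemifield is a finite additive abelian group with a multiplication that is distributive on both sides over addition and has no zero divisors ($x*y=0$ implies $x=0$ or $y=0$).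
   Formalization: The last condition is read as "p₁ ≠ 0 and p_{s,t} has no root in L" (no root at infinity either); without p₁ ≠ 0 the equivalence fails, e.g. m = s = 1, μ = 1, C₁ = 1, C₂ = 0, where p_{s,t} = X²+X+1 has no root in GF(2) but T(C₁) = 0. -}

module Defs where

open import Algebra.Apartness.Bundles using (HeytingCommutativeRing; HeytingField)
open import Algebra.Bundles using (CommutativeRing)
open import Algebra.Core using (Op₁; Op₂)
open import Algebra.Definitions using (Congruent₂; _DistributesOver_)
open import Algebra.Morphism.Structures using (module RingMorphisms)
open import Algebra.Structures using (IsAbelianGroup)
open import Data.Fin.Base using (Fin; toℕ)
open import Data.Nat.Base as ℕ using (ℕ)
open import Data.Product.Base using (∃; _×_; _,_)
open import Data.Sum.Base using (_⊎_)
open import Function.Bundles using (Inverse)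
open import Level using (Level; _⊔_; suc)
open import Relation.Binary.Bundles using (Setoid)
open import Relation.Binary.Core using (Rel)
import Algebra.Properties.CommutativeMonoid.Sum as Sum
import Algebra.Properties.Semiring.Exp as Exp
import Relation.Binary.PropositionalEquality.Properties as ≡

HasOrder : ∀ {a ℓ} → Setoid a ℓ → ℕ → Set (a ⊔ ℓ)
HasOrder S n = Inverse (≡.setoid (Fin n)) S

record IsPresemifield {a ℓ} {A : Set a} (_≈_ : Rel A ℓ)
                      (_+_ _∙_ : Op₂ A) (0# : A) (-_ : Op₁ A) : Set (a ⊔ ℓ) where
  field
    +-isAbelianGroup : IsAbelianGroup _≈_ _+_ 0# -_
    finite           : ∃ (HasOrder (IsAbelianGroup.setoid +-isAbelianGroup))
    ∙-cong           : Congruent₂ _≈_ _∙_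
    distrib          : _DistributesOver_ _≈_ _∙_ _+_
    noZeroDivisors   : ∀ x y → (x ∙ y) ≈ 0# → (x ≈ 0#) ⊎ (y ≈ 0#)

-- On a carrier of finite order, equality and the apartness relation of a
-- Heyting field are decidable, so this is a finite field in the classical sense.
record GF (q : ℕ) (c ℓ₁ ℓ₂ : Level) : Set (suc (c ⊔ ℓ₁ ⊔ ℓ₂)) where
  field
    heytingField : HeytingField c ℓ₁ ℓ₂

  commutativeRing : CommutativeRing c ℓ₁
  commutativeRing =
    HeytingCommutativeRing.commutativeRing (HeytingField.heytingCommutativeRing heytingField)

  open CommutativeRing commutativeRing public
  open Exp semiring public using (_^_)
  open Sum +-commutativeMonoid public using (sum-syntax)

  field
    order : HasOrder setoid q

  -- a + a² + a⁴ + ⋯ with n summands: the absolute trace of GF(2ᵐ) for n = m,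
  -- and μₛ for a = μ, n = s.
  frobeniusSum : ℕ → Carrier → Carrier
  frobeniusSum n a = sum-syntax n (λ i → a ^ (2 ℕ.^ toℕ i))

  projectivePolynomial : ℕ → Carrier × Carrier × Carrier × Carrier → Carrier → Carrier
  projectivePolynomial σ (a , b , c , d) X =
    a * X ^ (σ ℕ.+ 1) + b * X ^ σ + c * X + d

-- The inclusion L ⊂ F is an injective ring homomorphism ι.
record QuadraticExtension (m : ℕ) (c ℓ₁ ℓ₂ c′ ℓ₁′ ℓ₂′ : Level)
       : Set (suc (c ⊔ ℓ₁ ⊔ ℓ₂ ⊔ c′ ⊔ ℓ₁′ ⊔ ℓ₂′)) where
  field
    F-GF : GF (2 ℕ.^ (2 ℕ.* m)) c ℓ₁ ℓ₂
    L-GF : GF (2 ℕ.^ m) c′ ℓ₁′ ℓ₂′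

  module F = GF F-GF
  module L = GF L-GF

  open RingMorphisms L.rawRing F.rawRing using (IsRingMonomorphism)

  field
    ι                  : L.Carrier → F.Carrier
    isRingMonomorphism : IsRingMonomorphism ι

  open F

  conj : F.Carrier → F.Carrier
  conj x = x ^ (2 ℕ.^ m)

  T : F.Carrier → F.Carrier
  T x = x + conj x

  N : F.Carrier → F.Carrier
  N x = x * conj x

  fromCoordinates : F.Carrier → L.Carrier × L.Carrier → F.Carrier
  fromCoordinates z (a , b) = ι a + ι b * z

  product : (z : F.Carrier) (σ : ℕ) (C₁ C₂ : F.Carrier) → Op₂ F.Carrier
  product z σ C₁ C₂ x y =
    T ((C₁ * y ^ σ + C₂ * conj y ^ σ) * x) + T (x * y) * z

  quadruple : (μ : L.Carrier) (s : ℕ) (C₁ C₂ : L.Carrier × L.Carrier) →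
              L.Carrier × L.Carrier × L.Carrier × L.Carrier
  quadruple μ s (v₁ , h₁) (v₂ , h₂) =
      h₁ ⊕ h₂
    , v₁ ⊕ v₂ ⊕ h₁ ⊕ h₂
    , v₁ ⊕ v₂ ⊕ μₛ ⊗ h₁ ⊕ (μₛ ⊕ L.1#) ⊗ h₂
    , μₛ ⊗ v₁ ⊕ (μₛ ⊕ L.1#) ⊗ v₂ ⊕ (μₛ ⊕ μ) ⊗ h₁ ⊕ (μₛ ⊕ μ ⊕ L.1#) ⊗ h₂
    where
    infixl 6 _⊕_
    infixl 7 _⊗_
    _⊕_ _⊗_ : Op₂ L.Carrier
    _⊕_ = L._+_
    _⊗_ = L._*_
    μₛ : L.Carrier
    μₛ = L.frobeniusSum s μ

  -- No root on the projective line over L.  The clause p₁ ≉ 0 says that ∞ is not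
  -- a root, i.e. that the polynomial really has degree σ + 1; it cannot be
  -- dropped.  For m = s = 1, μ = 1, C₁ = 1, C₂ = 0 the quadruple is [0,1,1,1]:
  -- X² + X + 1 has no root in GF(2), but T(C₁ x x̄² + C₂ x³) = T(1) = 0 at x = 1.
  NoProjectiveRootInL : (σ : ℕ) → L.Carrier × L.Carrier × L.Carrier × L.Carrier →
                        Set (c′ ⊔ ℓ₁′)
  NoProjectiveRootInL σ t@(p₁ , _) =
      (p₁ L.≉ L.0#)
    × (∀ (X : L.Carrier) → L.projectivePolynomial σ t X L.≉ L.0#)

{-# OPTIONS --safe #-}

-- Write G(x) = T(C₁ x x̄^σ + C₂ x^(σ+1)).  Three substitutions give the theorem.
-- If T(xy) = 0 with y ≠ 0, then x = wȳ with w ∈ L, and the other coordinate of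
-- x * y is w G(ȳ); conversely x * x̄ = G(x).  If x = X x̄, then
-- G(x) = x̄^(σ+1) P(X), and by Hilbert 90 the X that occur are exactly those of
-- norm 1.  Finally G(wx) = w^(σ+1) G(x) for w ∈ L, so only x = 1 and x = w + z
-- with w ∈ L matter, where G(1) = p₁ and G(w + z) = p(w) by the relations
-- z̄ = z + 1 and z^σ = z + μₛ.
module Submission where

open import Algebra.Apartness.Bundles using (module HeytingField)
open import Algebra.Bundles using (CommutativeMonoid; CommutativeRing)
open import Algebra.Morphism.Structures using (module RingMorphisms)
open import Algebra.Solver.Ring.AlmostCommutativeRing
  using (fromCommutativeRing; _-Raw-AlmostCommutative⟶_; Induced-equivalence)
open import Data.Bool.Base using (true; false)
open import Data.Bool.Properties using (xor-∧-commutativeRing)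
open import Data.Empty using (⊥)
open import Data.Fin.Base using (Fin; zero; suc; toℕ; punchOut; punchIn; combine; remQuot)
open import Data.Fin.Properties as Fin
  using (any?; injective⇒≤; punchOut-injective; punchInᵢ≢i)
open import Data.Maybe.Base using (just; nothing)
open import Data.Nat.Base as ℕ using (ℕ; zero; suc; _≤_; _<_)
open import Data.Nat.Properties as ℕ using (≤-trans; 1+n≰n)
open import Data.Product.Base using (∃; ∃₂; _×_; _,_; proj₁; proj₂)
open import Data.Sum.Base using (_⊎_; inj₁; inj₂; [_,_]′)
open import Data.Vec.Functional using (Vector; replicate)
open import Defs
open import Function.Base using (_∘_; id)
open import Function.Bundles using (_⇔_; mk⇔; Inverse)
open import Function.Construct.Composition using (inverse; _⇔-∘_)
import Function.Construct.Symmetry as Symmetry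
open import Function.Definitions using (Injective)
open import Level using (Level; _⊔_)
open import Relation.Binary.Bundles using (Setoid)
open import Relation.Binary.Core using (_Preserves_⟶_)
open import Relation.Binary.Definitions using (Decidable; WeaklyDecidable)
open import Relation.Binary.PropositionalEquality.Core as ≡ using (_≡_; _≢_)
open import Relation.Nullary.Decidable.Core
  using (Dec; yes; no; map′; decidable-stable)
open import Relation.Nullary.Negation using (contradiction)
import Algebra.Properties.CommutativeMonoid.Sum as CommutativeMonoidSum
import Algebra.Properties.CommutativeSemiring.Exp as Exp
import Algebra.Properties.Group as GroupProperties
import Algebra.Properties.Semiring.Mult as Mult
import Algebra.Solver.Ring as RingSolver
import Relation.Binary.Reasoning.Setoid as SetoidReasoning

-- Of the two fields only their orders and the monomorphism `ι` are given, so the classical facts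
-- are won by counting. The order of L yields characteristic 2 and a^q = a, whence `conj` fixes the
-- image of `ι`; comparing the sizes of L × L and F makes 1, z a basis, and the coordinates in turn
-- make `conj` an involution. Where scalars are pulled out of T or G, membership of w in L is
-- expressed as `conj w ≈ w`. This suffices there, and a preimage of w under `ι` never has to be
-- found. The points 1 and w + z represent ∞ and w on the projective line over L, which is why p₁ ≠
-- 0 belongs to the last condition. The exponent σ is symbolic, out of reach of the ring solver.
-- Powers are therefore evaluated by Frobenius first, and the solver then treats x, x̄, x^σ, x̄^σ as
-- independent letters.

-- Finite sets and finite sums.

-- A missed value could be punched out of the codomain, leaving an injection into a set with fewer
-- than m elements.
injective⇒surjective : ∀ {m n} {f : Fin m → Fin n} → Injective _≡_ _≡_ f →
                       n ≤ m → ∀ y → ∃ λ x → f x ≡ y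
injective⇒surjective {m} {suc n} {f} f-inj n<m y with any? (λ x → f x Fin.≟ y)
... | yes found = found
... | no ¬found = contradiction (≤-trans n<m (injective⇒≤ g-inj)) 1+n≰n
  where
  y≢f : ∀ x → y ≢ f x
  y≢f x y≡fx = ¬found (x , ≡.sym y≡fx)
  g : Fin m → Fin n
  g x = punchOut (y≢f x)
  g-inj : Injective _≡_ _≡_ g
  g-inj {x} {x′} eq = f-inj (punchOut-injective (y≢f x) (y≢f x′) eq)

module _ {c ℓ} (M : CommutativeMonoid c ℓ) where
  open CommutativeMonoid M
  open CommutativeMonoidSum M

  sum-single : ∀ {n} (t : Vector Carrier n) i → (∀ j → j ≢ i → t j ≈ ε) → sum t ≈ t i
  sum-single {suc n} t i others = begin
    sum t                       ≈⟨ sum-remove {i = i} t ⟩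
    t i ∙ sum (t ∘ punchIn i)
      ≈⟨ ∙-congˡ (sum-cong-≋ λ j → others (punchIn i j) (punchInᵢ≢i i j)) ⟩
    t i ∙ sum (replicate n ε)   ≈⟨ ∙-congˡ (sum-replicate-zero n) ⟩
    t i ∙ ε                     ≈⟨ identityʳ (t i) ⟩
    t i                         ∎
    where open SetoidReasoning setoid

  -- Conjugating `f` by the enumeration `e` gives a permutation of `Fin n`. It is applied to
  -- translations in the additive monoid and to dilations in the multiplicative one.
  sum-bijection : ∀ {a ℓ′ n} {S : Setoid a ℓ′} (e : HasOrder S n) (f : Inverse S S)
                  {g : Setoid.Carrier S → Carrier} → g Preserves Setoid._≈_ S ⟶ _≈_ →
                  sum (g ∘ Inverse.to e) ≈ sum (g ∘ Inverse.to f ∘ Inverse.to e)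
  sum-bijection {n = n} e f {g} g-cong =
    trans (sum-permute (g ∘ Inverse.to e) (inverse (inverse e f) (Symmetry.inverse e)))
          (sum-cong-≋ {n} λ i → g-cong (Inverse.strictlyInverseˡ e (Inverse.to f (Inverse.to e i))))

-- Rings of characteristic two.

IsCharTwo : ∀ {c ℓ} → CommutativeRing c ℓ → Set ℓ
IsCharTwo R = 1# + 1# ≈ 0#
  where open CommutativeRing R

module CharTwo {c ℓ} (R : CommutativeRing c ℓ) (1+1≈0 : IsCharTwo R) where
  open CommutativeRing R hiding (zero)
  open Exp commutativeSemiring
  open GroupProperties +-group using (ε⁻¹≈ε; inverseʳ-unique)

  -- Over the coefficient ring ℤ/2 the solver knows that x + x vanishes.
  ℤ/2⟶R : CommutativeRing.rawRing xor-∧-commutativeRing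
            -Raw-AlmostCommutative⟶ fromCommutativeRing R
  ℤ/2⟶R = record
    { ⟦_⟧    = λ { false → 0# ; true → 1# }
    ; +-homo = λ { false y     → sym (+-identityˡ _)
                 ; true  false → sym (+-identityʳ 1#)
                 ; true  true  → sym 1+1≈0 }
    ; *-homo = λ { false y → sym (zeroˡ _) ; true y → sym (*-identityˡ _) }
    ; -‿homo = λ { false → sym ε⁻¹≈ε ; true → inverseʳ-unique 1# 1# 1+1≈0 }
    ; 0-homo = refl
    ; 1-homo = refl
    }

  coefficient≟ : WeaklyDecidable (Induced-equivalence ℤ/2⟶R)
  coefficient≟ false false = just refl
  coefficient≟ true  true  = just refl
  coefficient≟ _     _     = nothing

  open RingSolver (CommutativeRing.rawRing xor-∧-commutativeRing) (fromCommutativeRing R)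
                  ℤ/2⟶R coefficient≟ public
    using (solve; _:=_; _:+_; _:*_; _:^_; con)

  x+y≈0⇒x≈y : ∀ {x y} → x + y ≈ 0# → x ≈ y
  x+y≈0⇒x≈y {x} {y} x+y≈0 = begin
    x            ≈⟨ solve 2 (λ x y → x := (x :+ y) :+ y) refl x y ⟩
    x + y + y    ≈⟨ +-congʳ x+y≈0 ⟩
    0# + y       ≈⟨ +-identityˡ y ⟩
    y            ∎
    where open SetoidReasoning setoid

  -- Squaring is additive because the cross terms cancel, and x^(2ⁿ) is an iterated square. Both
  -- `conj` and x ↦ x^σ are of this kind.
  ^2ⁿ-distrib-+ : ∀ n x y → (x + y) ^ (2 ℕ.^ n) ≈ x ^ (2 ℕ.^ n) + y ^ (2 ℕ.^ n)
  ^2ⁿ-distrib-+ zero    x y =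
    solve 2 (λ x y → (x :+ y) :^ 1 := x :^ 1 :+ y :^ 1) refl x y
  ^2ⁿ-distrib-+ (suc n) x y = begin
    (x + y) ^ (2 ℕ.* 2 ℕ.^ n)                    ≈⟨ ^-assocʳ (x + y) 2 (2 ℕ.^ n) ⟨
    ((x + y) ^ 2) ^ (2 ℕ.^ n)
      ≈⟨ ^-congˡ (2 ℕ.^ n) (solve 2 (λ x y → (x :+ y) :^ 2 := x :^ 2 :+ y :^ 2) refl x y) ⟩
    (x ^ 2 + y ^ 2) ^ (2 ℕ.^ n)                  ≈⟨ ^2ⁿ-distrib-+ n (x ^ 2) (y ^ 2) ⟩
    (x ^ 2) ^ (2 ℕ.^ n) + (y ^ 2) ^ (2 ℕ.^ n)
      ≈⟨ +-cong (^-assocʳ x 2 (2 ℕ.^ n)) (^-assocʳ y 2 (2 ℕ.^ n)) ⟩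
    x ^ (2 ℕ.* 2 ℕ.^ n) + y ^ (2 ℕ.* 2 ℕ.^ n)    ∎
    where open SetoidReasoning setoid

-- Finite fields, studied through their order.

module FiniteField {q c ℓ₁ ℓ₂} (K : GF q c ℓ₁ ℓ₂) where
  open GF K hiding (zero)
  open HeytingField heytingField using (tight; #⇒invertible)
  open Exp commutativeSemiring hiding (_^_)
  open Mult semiring using (×1-homo-*) renaming (_×_ to _·_)
  open GroupProperties +-group using (ε⁻¹≈ε; identityʳ-unique)
  open Inverse order using (to-cong; from-cong; strictlyInverseˡ; strictlyInverseʳ)
    renaming (to to elem; from to index)
  open SetoidReasoning setoid
  module Σ = CommutativeMonoidSum +-commutativeMonoid
  module Π = CommutativeMonoidSum *-commutativeMonoid

  elem-injective : ∀ {i j} → elem i ≈ elem j → i ≡ j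
  elem-injective {i} {j} eq =
    ≡.trans (≡.sym (strictlyInverseʳ i)) (≡.trans (from-cong eq) (strictlyInverseʳ j))

  infix 4 _≟_

  _≟_ : Decidable _≈_
  x ≟ y = map′
    (λ i≡j → trans (sym (strictlyInverseˡ x)) (trans (to-cong i≡j) (strictlyInverseˡ y)))
    from-cong (index x Fin.≟ index y)

  -- A Heyting field only inverts elements apart from 0; the search through the
  -- enumeration turns the double negation of "x # 0" into an actual inverse.
  recip : ∀ {x} → x ≉ 0# → ∃ λ y → x * y ≈ 1#
  recip {x} x≉0 = decidable-stable invertible? λ ¬invertible →
    x≉0 (proj₁ (tight x 0#) λ x#0 →
      let y , _ , [x-0]y≈1 = #⇒invertible x#0
          x≈x-0 = sym (trans (+-congˡ ε⁻¹≈ε) (+-identityʳ x))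
      in ¬invertible (y , trans (*-congʳ x≈x-0) [x-0]y≈1))
    where
    invertible? : Dec (∃ λ y → x * y ≈ 1#)
    invertible? = map′ (λ (i , p) → elem i , p)
      (λ (y , p) → index y , trans (*-congˡ (strictlyInverseˡ y)) p)
      (any? λ i → x * elem i ≟ 1#)

  *-cancelˡ : ∀ {x y z} → x ≉ 0# → x * y ≈ x * z → y ≈ z
  *-cancelˡ {x} {y} {z} x≉0 xy≈xz with r , xr≈1 ← recip x≉0 = begin
    y            ≈⟨ *-identityˡ y ⟨
    1# * y       ≈⟨ *-congʳ (trans (*-comm r x) xr≈1) ⟨
    r * x * y    ≈⟨ *-assoc r x y ⟩
    r * (x * y)  ≈⟨ *-congˡ xy≈xz ⟩
    r * (x * z)  ≈⟨ *-assoc r x z ⟨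
    r * x * z    ≈⟨ *-congʳ (trans (*-comm r x) xr≈1) ⟩
    1# * z       ≈⟨ *-identityˡ z ⟩
    z            ∎

  x*y≈0⇒y≈0 : ∀ {x y} → x ≉ 0# → x * y ≈ 0# → y ≈ 0#
  x*y≈0⇒y≈0 {x} x≉0 xy≈0 = *-cancelˡ x≉0 (trans xy≈0 (sym (zeroʳ x)))

  x*y≉0 : ∀ {x y} → x ≉ 0# → y ≉ 0# → x * y ≉ 0#
  x*y≉0 x≉0 y≉0 xy≈0 = y≉0 (x*y≈0⇒y≈0 x≉0 xy≈0)

  translation : Carrier → Inverse setoid setoid
  translation a = record
    { to        = _+ a
    ; from      = _- a
    ; to-cong   = +-congʳ
    ; from-cong = +-congʳ
    ; inverse   = (λ y≈x-a → trans (+-congʳ y≈x-a) (trans (+-assoc _ _ _)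
                    (trans (+-congˡ (-‿inverseˡ a)) (+-identityʳ _))))
                , (λ y≈x+a → trans (+-congʳ y≈x+a) (trans (+-assoc _ _ _)
                    (trans (+-congˡ (-‿inverseʳ a)) (+-identityʳ _))))
    }

  dilation : ∀ {a} → a ≉ 0# → Inverse setoid setoid
  dilation {a} a≉0 with r , ar≈1 ← recip a≉0 = record
    { to        = a *_
    ; from      = r *_
    ; to-cong   = *-congˡ
    ; from-cong = *-congˡ
    ; inverse   = (λ y≈rx → trans (*-congˡ y≈rx) (trans (sym (*-assoc _ _ _))
                    (trans (*-congʳ ar≈1) (*-identityˡ _))))
                , (λ y≈ax → trans (*-congˡ y≈ax) (trans (sym (*-assoc _ _ _))
                    (trans (*-congʳ (trans (*-comm r a) ar≈1)) (*-identityˡ _))))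
    }

  -- The sum of all elements is invariant under the translation by 1.
  order·1≈0 : q · 1# ≈ 0#
  order·1≈0 = identityʳ-unique (Σ.sum elem) (q · 1#) (begin
    Σ.sum elem + q · 1#                  ≈⟨ +-congˡ (Σ.sum-replicate q) ⟨
    Σ.sum elem + Σ.sum (replicate q 1#)  ≈⟨ Σ.∑-distrib-+ elem (replicate q 1#) ⟨
    Σ.sum (λ i → elem i + 1#)
      ≈⟨ sum-bijection +-commutativeMonoid order (translation 1#) id ⟨
    Σ.sum elem                           ∎)

  -- As 2ⁿ⁺¹·1 is the product of 2·1 and 2ⁿ·1, one factor vanishes. The descent ends at n = 0, where
  -- 1 = 0 and the claim is trivial.
  2ⁿ·1≈0⇒1+1≈0 : ∀ n → (2 ℕ.^ n) · 1# ≈ 0# → 1# + 1# ≈ 0#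
  2ⁿ·1≈0⇒1+1≈0 zero 1≈0 = trans (+-congˡ (trans (sym (+-identityʳ 1#)) 1≈0))
                                (trans (+-identityʳ 1#) (trans (sym (+-identityʳ 1#)) 1≈0))
  2ⁿ·1≈0⇒1+1≈0 (suc n) 2ⁿ⁺¹≈0 with 2 · 1# ≟ 0#
  ... | yes 2≈0 = trans (+-congˡ (sym (+-identityʳ 1#))) 2≈0
  ... | no  2≉0 = 2ⁿ·1≈0⇒1+1≈0 n
    (x*y≈0⇒y≈0 2≉0 (trans (sym (×1-homo-* 2 (2 ℕ.^ n))) 2ⁿ⁺¹≈0))

  -- The enumeration runs through 0 too; a product over it can be cancelled only after its factor at
  -- 0 has been exchanged.
  replaceZero : Carrier → Carrier → Carrier → Carrier
  replaceZero a b x with x ≟ 0#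
  ... | yes _ = a
  ... | no  _ = b

  replaceZero-≈0 : ∀ {a b x} → x ≈ 0# → replaceZero a b x ≈ a
  replaceZero-≈0 {x = x} x≈0 with x ≟ 0#
  ... | yes _   = refl
  ... | no  x≉0 = contradiction x≈0 x≉0

  replaceZero-≉0 : ∀ {a b x} → x ≉ 0# → replaceZero a b x ≈ b
  replaceZero-≉0 {x = x} x≉0 with x ≟ 0#
  ... | yes x≈0 = contradiction x≈0 x≉0
  ... | no  _   = refl

  Π-≉0 : 1# ≉ 0# → ∀ {n} (t : Vector Carrier n) → (∀ i → t i ≉ 0#) → Π.sum t ≉ 0#
  Π-≉0 1≉0 {zero}  t t≉0 = 1≉0
  Π-≉0 1≉0 {suc n} t t≉0 = x*y≉0 (t≉0 zero) (Π-≉0 1≉0 (t ∘ suc) (t≉0 ∘ suc))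

  -- With u x = x for x ≉ 0, u 0 = 1 and e x = 1 for x ≉ 0, e 0 = a, one has
  -- a · u x = u (a · x) · e x; taking products over all x, ∏ u cancels.
  a^order≈a : ∀ a → a ^ q ≈ a
  a^order≈a a with a ≟ 0#
  -- 0^q = 0 needs q to be positive, and `index a`, an element of `Fin q`, witnesses that.
  ... | yes a≈0 = trans (^-congˡ q a≈0) (trans (0^ (index a)) (sym a≈0))
    where
    0^ : ∀ {n} → Fin n → 0# ^ n ≈ 0#
    0^ {suc n} _ = zeroˡ (0# ^ n)
  ... | no a≉0 = *-cancelˡ Πu≉0 (begin
    Π.sum (u ∘ elem) * a ^ q                          ≈⟨ *-comm _ _ ⟩
    a ^ q * Π.sum (u ∘ elem)                          ≈⟨ *-congʳ (Π.sum-replicate q) ⟨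
    Π.sum (replicate q a) * Π.sum (u ∘ elem)          ≈⟨ Π.∑-distrib-+ (replicate q a) (u ∘ elem) ⟨
    Π.sum (λ i → a * u (elem i))                      ≈⟨ Π.sum-cong-≋ (λ i → step (elem i)) ⟩
    Π.sum (λ i → u (a * elem i) * e (elem i))
      ≈⟨ Π.∑-distrib-+ (λ i → u (a * elem i)) (e ∘ elem) ⟩
    Π.sum (λ i → u (a * elem i)) * Π.sum (e ∘ elem)
      ≈⟨ *-cong (sym (sum-bijection *-commutativeMonoid order (dilation a≉0) u-cong)) Πe≈a ⟩
    Π.sum (u ∘ elem) * a                              ∎)
    where
    u e : Carrier → Carrier
    u x = replaceZero 1# x x
    e x = replaceZero a 1# x

    u-cong : u Preserves _≈_ ⟶ _≈_
    u-cong {x} {y} x≈y with x ≟ 0# | y ≟ 0#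
    ... | yes _   | yes _   = refl
    ... | no  _   | no  _   = x≈y
    ... | yes x≈0 | no  y≉0 = contradiction (trans (sym x≈y) x≈0) y≉0
    ... | no  x≉0 | yes y≈0 = contradiction (trans x≈y y≈0) x≉0

    step : ∀ x → a * u x ≈ u (a * x) * e x
    step x with x ≟ 0#
    ... | yes x≈0 = begin
      a * 1#          ≈⟨ *-comm a 1# ⟩
      1# * a          ≈⟨ *-congʳ (replaceZero-≈0 (trans (*-congˡ x≈0) (zeroʳ a))) ⟨
      u (a * x) * a   ∎
    ... | no x≉0 = begin
      a * x           ≈⟨ replaceZero-≉0 (x*y≉0 a≉0 x≉0) ⟨
      u (a * x)       ≈⟨ *-identityʳ _ ⟨
      u (a * x) * 1#  ∎

    1≉0 : 1# ≉ 0#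
    1≉0 1≈0 = a≉0 (trans (sym (*-identityˡ a)) (trans (*-congʳ 1≈0) (zeroˡ a)))

    u≉0 : ∀ x → u x ≉ 0#
    u≉0 x with x ≟ 0#
    ... | yes _   = 1≉0
    ... | no  x≉0 = x≉0

    Πu≉0 : Π.sum (u ∘ elem) ≉ 0#
    Πu≉0 = Π-≉0 1≉0 (u ∘ elem) (u≉0 ∘ elem)

    Πe≈a : Π.sum (e ∘ elem) ≈ a
    Πe≈a = trans
      (sum-single *-commutativeMonoid (e ∘ elem) (index 0#) λ j j≢ → replaceZero-≉0 λ ej≈0 →
        j≢ (≡.trans (≡.sym (strictlyInverseʳ j)) (from-cong ej≈0)))
      (replaceZero-≈0 (strictlyInverseˡ 0#))

  -- Splitting off the first summand leaves the sum for a², the form in which the induction of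
  -- `Artin-Schreier-^2ˢ` meets it.
  frobeniusSum-suc : ∀ n a → frobeniusSum (suc n) a ≈ a + frobeniusSum n (a ^ 2)
  frobeniusSum-suc n a = +-cong (*-identityʳ a)
    (Σ.sum-cong-≋ {n} λ (i : Fin n) → sym (^-assocʳ a 2 (2 ℕ.^ toℕ i)))

  -- If 1 = 0, all elements coincide, and the constant map from `Fin q` to `Fin 1` would be
  -- injective.
  1≉0 : 1 < q → 1# ≉ 0#
  1≉0 1<q 1≈0 = 1+n≰n (≤-trans 1<q (injective⇒≤ {f = λ (_ : Fin q) → zero {0}} λ {i} {j} _ →
    elem-injective (trans (x≈0 (elem i)) (sym (x≈0 (elem j))))))
    where
    x≈0 : ∀ x → x ≈ 0#
    x≈0 x = trans (sym (*-identityˡ x)) (trans (*-congʳ 1≈0) (zeroˡ x))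

  x^n≉0 : 1# ≉ 0# → ∀ {x} n → x ≉ 0# → x ^ n ≉ 0#
  x^n≉0 1≉0 zero    x≉0 = 1≉0
  x^n≉0 1≉0 (suc n) x≉0 = x*y≉0 x≉0 (x^n≉0 1≉0 n x≉0)

  1^n≈1 : ∀ n → 1# ^ n ≈ 1#
  1^n≈1 zero    = refl
  1^n≈1 (suc n) = trans (*-identityˡ _) (1^n≈1 n)

  x^[n+1]≈x^n*x : ∀ x n → x ^ (n ℕ.+ 1) ≈ x ^ n * x
  x^[n+1]≈x^n*x x n = trans (^-homo-* x n 1) (*-congˡ (*-identityʳ x))

-- The extension of L by F: conjugation, trace, norm and the basis 1, z.

module Extension {c ℓ₁ ℓ₂ c′ ℓ₁′ ℓ₂′} {m : ℕ} (1≤m : 1 ≤ m)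
                 (E : QuadraticExtension m c ℓ₁ ℓ₂ c′ ℓ₁′ ℓ₂′) where
  open QuadraticExtension E
  open F hiding (zero)
  open Exp commutativeSemiring hiding (_^_)
  open RingMorphisms L.rawRing F.rawRing using (module IsRingMonomorphism)
  open IsRingMonomorphism isRingMonomorphism
    using (+-homo; *-homo; 0#-homo; 1#-homo)
    renaming (⟦⟧-cong to ι-cong; injective to ι-injective)
  module LF = FiniteField L-GF
  module FF = FiniteField F-GF
  open FF using (recip; x*y≈0⇒y≈0; x*y≉0; *-cancelˡ; x^[n+1]≈x^n*x; _≟_)
  open SetoidReasoning setoid

  1≉0ᴸ : L.1# L.≉ L.0#
  -- From m ≥ 1 follows 2 = 2^1 ≤ 2^m, so L has two distinct elements.
  1≉0ᴸ = LF.1≉0 (ℕ.^-monoʳ-≤ 2 1≤m)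

  1≉0 : 1# ≉ 0#
  1≉0 1≈0 = 1≉0ᴸ (ι-injective (trans 1#-homo (trans 1≈0 (sym 0#-homo))))

  1+1≈0 : 1# + 1# ≈ 0#
  1+1≈0 = begin
    1# + 1#            ≈⟨ +-cong 1#-homo 1#-homo ⟨
    ι L.1# + ι L.1#    ≈⟨ +-homo L.1# L.1# ⟨
    ι (L.1# L.+ L.1#)  ≈⟨ ι-cong (LF.2ⁿ·1≈0⇒1+1≈0 m LF.order·1≈0) ⟩
    ι L.0#             ≈⟨ 0#-homo ⟩
    0#                 ∎

  open CharTwo commutativeRing 1+1≈0

  x+x≈0 : ∀ x → x + x ≈ 0#
  x+x≈0 = solve 1 (λ x → x :+ x := con false) refl

  infixl 6 _⟨+⟩_
  infixl 7 _⟨*⟩_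

  -- With `_⟨*⟩_`, this pushes `ι` through an expression by a proof term of the same shape; `refl`
  -- marks a leaf kept as `ι a`.
  _⟨+⟩_ : ∀ {a b x y} → ι a ≈ x → ι b ≈ y → ι (a L.+ b) ≈ x + y
  ιa≈x ⟨+⟩ ιb≈y = trans (+-homo _ _) (+-cong ιa≈x ιb≈y)

  _⟨*⟩_ : ∀ {a b x y} → ι a ≈ x → ι b ≈ y → ι (a L.* b) ≈ x * y
  ιa≈x ⟨*⟩ ιb≈y = trans (*-homo _ _) (*-cong ιa≈x ιb≈y)

  ι-^ : ∀ a n → ι (a L.^ n) ≈ ι a ^ n
  ι-^ a zero    = 1#-homo
  ι-^ a (suc n) = refl ⟨*⟩ ι-^ a n

  ι-≉0 : ∀ {a} → a L.≉ L.0# → ι a ≉ 0#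
  ι-≉0 a≉0 ιa≈0 = a≉0 (ι-injective (trans ιa≈0 (sym 0#-homo)))

  ι-projectivePolynomial : ∀ n {a b c d x} X → ι X ≈ x →
    ι (L.projectivePolynomial n (a , b , c , d) X)
      ≈ F.projectivePolynomial n (ι a , ι b , ι c , ι d) x
  ι-projectivePolynomial n X ιX≈x =
    refl ⟨*⟩ power (n ℕ.+ 1) ⟨+⟩ refl ⟨*⟩ power n ⟨+⟩ refl ⟨*⟩ ιX≈x ⟨+⟩ refl
    where
    power : ∀ k → ι (X L.^ k) ≈ _ ^ k
    power k = trans (ι-^ X k) (^-congˡ k ιX≈x)

  conj-cong : ∀ {x y} → x ≈ y → conj x ≈ conj y
  conj-cong = ^-congˡ (2 ℕ.^ m)

  conj-+ : ∀ x y → conj (x + y) ≈ conj x + conj y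
  conj-+ = ^2ⁿ-distrib-+ m

  conj-* : ∀ x y → conj (x * y) ≈ conj x * conj y
  conj-* x y = ^-distrib-* x y (2 ℕ.^ m)

  conj-^ : ∀ x n → conj (x ^ n) ≈ conj x ^ n
  conj-^ x n = begin
    (x ^ n) ^ (2 ℕ.^ m)      ≈⟨ ^-assocʳ x n (2 ℕ.^ m) ⟩
    x ^ (n ℕ.* 2 ℕ.^ m)      ≈⟨ ^-congʳ x (ℕ.*-comm n (2 ℕ.^ m)) ⟩
    x ^ (2 ℕ.^ m ℕ.* n)      ≈⟨ ^-assocʳ x (2 ℕ.^ m) n ⟨
    (x ^ (2 ℕ.^ m)) ^ n      ∎

  conj-ι : ∀ a → conj (ι a) ≈ ι a
  conj-ι a = trans (sym (ι-^ a (2 ℕ.^ m))) (ι-cong (LF.a^order≈a a))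

  conj-1 : conj 1# ≈ 1#
  conj-1 = FF.1^n≈1 (2 ℕ.^ m)

  T-cong : ∀ {x y} → x ≈ y → T x ≈ T y
  T-cong x≈y = +-cong x≈y (conj-cong x≈y)

  T-+ : ∀ x y → T (x + y) ≈ T x + T y
  T-+ x y = trans (+-congˡ (conj-+ x y))
    (solve 4 (λ x y x̄ ȳ → x :+ y :+ (x̄ :+ ȳ) := x :+ x̄ :+ (y :+ ȳ)) refl x y (conj x) (conj y))

  T-homogeneous : ∀ {w} → conj w ≈ w → ∀ x → T (w * x) ≈ w * T x
  T-homogeneous {w} w̄≈w x = trans (+-congˡ (trans (conj-* w x) (*-congʳ w̄≈w)))
    (sym (distribˡ w x (conj x)))

  -- The induction varies z and μ: z² satisfies the same equation with μ² for μ, and z² = z + μ. The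
  -- exponent m, with trace 1, gives z̄ = z + 1; the exponent s gives z^σ.
  Artin-Schreier-^2ˢ : ∀ s {μ z} → z ^ 2 + z ≈ ι μ → z ^ (2 ℕ.^ s) ≈ z + ι (L.frobeniusSum s μ)
  Artin-Schreier-^2ˢ zero {μ} {z} _ =
    trans (*-identityʳ z) (sym (trans (+-congˡ 0#-homo) (+-identityʳ z)))
  Artin-Schreier-^2ˢ (suc s) {μ} {z} z²+z≈μ = begin
    z ^ (2 ℕ.* 2 ℕ.^ s)                        ≈⟨ ^-assocʳ z 2 (2 ℕ.^ s) ⟨
    (z ^ 2) ^ (2 ℕ.^ s)                        ≈⟨ Artin-Schreier-^2ˢ s squared ⟩
    z ^ 2 + ι (L.frobeniusSum s (μ L.^ 2))
      ≈⟨ solve 2 (λ z S → z :^ 2 :+ S := z :+ (z :^ 2 :+ z :+ S)) refl z _ ⟩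
    z + (z ^ 2 + z + ι (L.frobeniusSum s (μ L.^ 2)))
      ≈⟨ +-congˡ (sym (trans (ι-cong (LF.frobeniusSum-suc s μ)) (sym z²+z≈μ ⟨+⟩ refl))) ⟩
    z + ι (L.frobeniusSum (suc s) μ)           ∎
    where
    squared : (z ^ 2) ^ 2 + z ^ 2 ≈ ι (μ L.^ 2)
    squared = begin
      (z ^ 2) ^ 2 + z ^ 2  ≈⟨ solve 1 (λ z → (z :^ 2) :^ 2 :+ z :^ 2 := (z :^ 2 :+ z) :^ 2) refl z ⟩
      (z ^ 2 + z) ^ 2      ≈⟨ ^-congˡ 2 z²+z≈μ ⟩
      ι μ ^ 2              ≈⟨ ι-^ μ 2 ⟨
      ι (μ L.^ 2)          ∎

  module _ (μ : L.Carrier) (trace : L.frobeniusSum m μ L.≈ L.1#)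
           (z : F.Carrier) (z²+z≈μ : z ^ 2 + z ≈ ι μ) where

    conj-z : conj z ≈ z + 1#
    conj-z = trans (Artin-Schreier-^2ˢ m z²+z≈μ) (+-congˡ (trans (ι-cong trace) 1#-homo))

    conj-coordinates : ∀ a b → conj (ι a + ι b * z) ≈ ι a + ι b * (z + 1#)
    conj-coordinates a b = trans (conj-+ _ _)
      (+-cong (conj-ι a) (trans (conj-* _ _) (*-cong (conj-ι b) conj-z)))

    -- Conjugating the relation replaces z by z + 1, and the sum of both relations is v. Asking only
    -- for fixed points of `conj` lets it apply directly to traces.
    independent : ∀ {u v} → conj u ≈ u → conj v ≈ v → u + v * z ≈ 0# → u ≈ 0# × v ≈ 0#
    independent {u} {v} ū≈u v̄≈v u+vz≈0 = u≈0 , v≈0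
      where
      conjugate : u + v * (z + 1#) ≈ 0#
      conjugate = begin
        u + v * (z + 1#)     ≈⟨ +-cong ū≈u (*-cong v̄≈v conj-z) ⟨
        conj u + conj v * conj z  ≈⟨ trans (conj-+ u (v * z)) (+-congˡ (conj-* v z)) ⟨
        conj (u + v * z)     ≈⟨ conj-cong (trans u+vz≈0 (sym 0#-homo)) ⟩
        conj (ι L.0#)        ≈⟨ trans (conj-ι L.0#) 0#-homo ⟩
        0#                   ∎
      v≈0 : v ≈ 0#
      v≈0 = begin
        v  ≈⟨ solve 3 (λ u v z → v := u :+ v :* (z :+ con true) :+ (u :+ v :* z)) refl u v z ⟩
        u + v * (z + 1#) + (u + v * z)  ≈⟨ +-cong conjugate u+vz≈0 ⟩
        0# + 0#                         ≈⟨ +-identityˡ 0# ⟩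
        0#                              ∎
      u≈0 : u ≈ 0#
      u≈0 = begin
        u          ≈⟨ +-identityʳ u ⟨
        u + 0#     ≈⟨ +-congˡ (trans (*-congʳ v≈0) (zeroˡ z)) ⟨
        u + v * z  ≈⟨ u+vz≈0 ⟩
        0#         ∎

    fromCoordinates-injective : ∀ {a b a′ b′} → ι a + ι b * z ≈ ι a′ + ι b′ * z →
                                a L.≈ a′ × b L.≈ b′
    fromCoordinates-injective {a} {b} {a′} {b′} eq =
        ι-injective (x+y≈0⇒x≈y (trans (sym (refl ⟨+⟩ refl)) (proj₁ difference≈0)))
      , ι-injective (x+y≈0⇒x≈y (trans (sym (refl ⟨+⟩ refl)) (proj₂ difference≈0)))
      where
      difference≈0 : ι (a L.+ a′) ≈ 0# × ι (b L.+ b′) ≈ 0#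
      difference≈0 = independent (conj-ι _) (conj-ι _) (begin
        ι (a L.+ a′) + ι (b L.+ b′) * z
          ≈⟨ +-cong (refl ⟨+⟩ refl) (*-congʳ (refl ⟨+⟩ refl)) ⟩
        (ι a + ι a′) + (ι b + ι b′) * z
          ≈⟨ solve 5 (λ a b a′ b′ z → (a :+ a′) :+ (b :+ b′) :* z
               := a :+ b :* z :+ (a′ :+ b′ :* z)) refl (ι a) (ι b) (ι a′) (ι b′) z ⟩
        (ι a + ι b * z) + (ι a′ + ι b′ * z)      ≈⟨ +-congʳ eq ⟩
        (ι a′ + ι b′ * z) + (ι a′ + ι b′ * z)    ≈⟨ x+x≈0 _ ⟩
        0#                                       ∎)

    -- An injection L × L → F between finite sets of equal size.
    coordinates : ∀ x → ∃₂ λ a b → x ≈ ι a + ι b * z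
    coordinates x =
      let k , fk≡x = injective⇒surjective f-injective (ℕ.≤-reflexive size) (Inverse.from F.order x)
      in a k , b k , (begin
        x                                            ≈⟨ Inverse.strictlyInverseˡ F.order x ⟨
        Inverse.to F.order (Inverse.from F.order x)  ≡⟨ ≡.cong (Inverse.to F.order) fk≡x ⟨
        Inverse.to F.order (f k)                     ≈⟨ Inverse.strictlyInverseˡ F.order _ ⟩
        ι (a k) + ι (b k) * z                        ∎)
      where
      q = 2 ℕ.^ m
      a b : Fin (q ℕ.* q) → L.Carrier
      a k = Inverse.to L.order (proj₁ (remQuot {q} q k))
      b k = Inverse.to L.order (proj₂ (remQuot {q} q k))
      f : Fin (q ℕ.* q) → Fin (2 ℕ.^ (2 ℕ.* m))
      f k = Inverse.from F.order (ι (a k) + ι (b k) * z)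
      size : 2 ℕ.^ (2 ℕ.* m) ≡ q ℕ.* q
      size = ≡.trans (≡.cong (λ n → 2 ℕ.^ (m ℕ.+ n)) (ℕ.+-identityʳ m)) (ℕ.^-distribˡ-+-* 2 m m)
      f-injective : Injective _≡_ _≡_ f
      f-injective {k} {k′} fk≡fk′ = ≡.trans (≡.sym (Fin.combine-remQuot {q} q k))
        (≡.trans (≡.cong₂ combine (LF.elem-injective (proj₁ ab≈)) (LF.elem-injective (proj₂ ab≈)))
          (Fin.combine-remQuot {q} q k′))
        where
        ab≈ : a k L.≈ a k′ × b k L.≈ b k′
        ab≈ = fromCoordinates-injective (begin
          ι (a k) + ι (b k) * z      ≈⟨ Inverse.strictlyInverseˡ F.order _ ⟨
          Inverse.to F.order (f k)   ≡⟨ ≡.cong (Inverse.to F.order) fk≡fk′ ⟩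
          Inverse.to F.order (f k′)  ≈⟨ Inverse.strictlyInverseˡ F.order _ ⟩
          ι (a k′) + ι (b k′) * z    ∎)

    conj-shift : ∀ {x a b} → x ≈ ι a + ι b * z → conj x ≈ x + ι b
    conj-shift {x} {a} {b} x≈ = begin
      conj x                     ≈⟨ conj-cong x≈ ⟩
      conj (ι a + ι b * z)       ≈⟨ conj-coordinates a b ⟩
      ι a + ι b * (z + 1#)
        ≈⟨ solve 3 (λ a b z → a :+ b :* (z :+ con true) := a :+ b :* z :+ b) refl (ι a) (ι b) z ⟩
      ι a + ι b * z + ι b        ≈⟨ +-congʳ x≈ ⟨
      x + ι b                    ∎

    -- Conjugation adds `ι b`, which it fixes; applied twice it adds `ι b` twice, that is 0.
    conj-involutive : ∀ x → conj (conj x) ≈ x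
    conj-involutive x = let a , b , x≈ = coordinates x in begin
      conj (conj x)           ≈⟨ conj-cong (conj-shift x≈) ⟩
      conj (x + ι b)          ≈⟨ conj-+ x (ι b) ⟩
      conj x + conj (ι b)     ≈⟨ +-cong (conj-shift x≈) (conj-ι b) ⟩
      x + ι b + ι b           ≈⟨ solve 2 (λ x b → x :+ b :+ b := x) refl x (ι b) ⟩
      x                       ∎

    conj-T : ∀ x → conj (T x) ≈ T x
    conj-T x = trans (conj-+ x (conj x)) (trans (+-congˡ (conj-involutive x)) (+-comm _ _))

    conj-≉0 : ∀ {x} → x ≉ 0# → conj x ≉ 0#
    conj-≉0 = FF.x^n≉0 1≉0 (2 ℕ.^ m)

    -- X(X̄ + 1) = N(X) + X = 1 + X, so x = X + 1 works unless it is 0; then X = 1 and x = 1 works.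
    hilbert90 : ∀ X → N X ≈ 1# → ∃ λ x → x ≉ 0# × X * conj x ≈ x
    hilbert90 X NX≈1 with X + 1# ≟ 0#
    ... | yes X+1≈0 = 1# , 1≉0 , trans (*-cong (x+y≈0⇒x≈y X+1≈0) conj-1) (*-identityˡ 1#)
    ... | no  X+1≉0 = X + 1# , X+1≉0 , (begin
      X * conj (X + 1#)    ≈⟨ *-congˡ (trans (conj-+ X 1#) (+-congˡ conj-1)) ⟩
      X * (conj X + 1#)    ≈⟨ distribˡ X (conj X) 1# ⟩
      N X + X * 1#         ≈⟨ +-cong NX≈1 (*-identityʳ X) ⟩
      1# + X               ≈⟨ +-comm 1# X ⟩
      X + 1#               ∎)

    -- X is x/x̄. Its norm is checked after multiplication by x̄, so X̄ need not be computed from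
    -- the inverse: x̄XX̄ = X̄x is the conjugate of Xx̄ = x.
    norm1-quotient : ∀ {x} → x ≉ 0# → ∃ λ X → N X ≈ 1# × X * conj x ≈ x
    norm1-quotient {x} x≉0 = X , *-cancelˡ (conj-≉0 x≉0) (begin
        conj x * (X * conj X)
          ≈⟨ solve 3 (λ x̄ X X̄ → x̄ :* (X :* X̄) := X̄ :* (X :* x̄)) refl (conj x) X (conj X) ⟩
        conj X * (X * conj x)      ≈⟨ *-congˡ Xx̄≈x ⟩
        conj X * x                 ≈⟨ *-congˡ (conj-involutive x) ⟨
        conj X * conj (conj x)     ≈⟨ conj-* X (conj x) ⟨
        conj (X * conj x)          ≈⟨ conj-cong Xx̄≈x ⟩
        conj x                     ≈⟨ *-identityʳ _ ⟨
        conj x * 1#                ∎) , Xx̄≈x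
      where
      r = proj₁ (recip (conj-≉0 x≉0))
      X = x * r
      Xx̄≈x : X * conj x ≈ x
      Xx̄≈x = begin
        x * r * conj x    ≈⟨ solve 3 (λ x r x̄ → x :* r :* x̄ := x :* (x̄ :* r)) refl x r (conj x) ⟩
        x * (conj x * r)  ≈⟨ *-congˡ (proj₂ (recip (conj-≉0 x≉0))) ⟩
        x * 1#            ≈⟨ *-identityʳ x ⟩
        x                 ∎

    -- The form G, written `form`, and the polynomials `P` and `p`.

    module Semifield (s : ℕ) (v₁ h₁ v₂ h₂ : L.Carrier) where
      σ : ℕ
      σ = 2 ℕ.^ s

      C₁ C₂ : F.Carrier
      C₁ = fromCoordinates z (v₁ , h₁)
      C₂ = fromCoordinates z (v₂ , h₂)

      form : F.Carrier → F.Carrier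
      form x = T (C₁ * x * conj x ^ σ + C₂ * x ^ (σ ℕ.+ 1))

      P : F.Carrier → F.Carrier
      P = F.projectivePolynomial σ (C₂ , conj C₁ , C₁ , conj C₂)

      p : L.Carrier → L.Carrier
      p = L.projectivePolynomial σ (quadruple μ s (v₁ , h₁) (v₂ , h₂))

      _∗_ : F.Carrier → F.Carrier → F.Carrier
      _∗_ = product z σ C₁ C₂

      -- The caller supplies the values of x̄, x^σ and x̄^σ; what remains is a polynomial in these
      -- letters, ready for the solver.
      form-expand : ∀ {x y u v} → conj x ≈ y → x ^ σ ≈ u → y ^ σ ≈ v →
        form x ≈ C₁ * x * v + C₂ * (u * x) + (conj C₁ * y * u + conj C₂ * (v * y))
      form-expand {x} {y} {u} {v} x̄≈y xσ≈u yσ≈v = +-cong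
        (+-cong (*-congˡ x̄σ≈v) (*-congˡ xσ+1≈ux))
        (trans (conj-+ _ _) (+-cong
          (trans (conj-* _ _) (*-cong (trans (conj-* _ _) (*-congˡ x̄≈y)) conj-v))
          (trans (conj-* _ _) (*-congˡ (trans (conj-cong xσ+1≈ux)
            (trans (conj-* _ _) (*-cong conj-u x̄≈y)))))))
        where
        x̄σ≈v : conj x ^ σ ≈ v
        x̄σ≈v = trans (^-congˡ σ x̄≈y) yσ≈v
        xσ+1≈ux : x ^ (σ ℕ.+ 1) ≈ u * x
        xσ+1≈ux = trans (x^[n+1]≈x^n*x x σ) (*-congʳ xσ≈u)
        conj-u : conj u ≈ v
        conj-u = trans (conj-cong (sym xσ≈u)) (trans (conj-^ x σ) x̄σ≈v)
        conj-v : conj (conj x ^ σ) ≈ u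
        conj-v = trans (conj-^ (conj x) σ) (trans (^-congˡ σ (conj-involutive x)) xσ≈u)

      form-cong : ∀ {x y} → x ≈ y → form x ≈ form y
      form-cong x≈y = T-cong (+-cong (*-cong (*-congˡ x≈y) (^-congˡ σ (conj-cong x≈y)))
                                     (*-congˡ (^-congˡ (σ ℕ.+ 1) x≈y)))

      form-homogeneous : ∀ {w} x → conj w ≈ w → form (w * x) ≈ w ^ σ * w * form x
      form-homogeneous {w} x w̄≈w = begin
        form (w * x)
          ≈⟨ form-expand (trans (conj-* w x) (*-congʳ w̄≈w)) (^-distrib-* w x σ)
                         (^-distrib-* w (conj x) σ) ⟩
        C₁ * (w * x) * (w ^ σ * conj x ^ σ) + C₂ * (w ^ σ * x ^ σ * (w * x))
          + (conj C₁ * (w * conj x) * (w ^ σ * x ^ σ)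
             + conj C₂ * (w ^ σ * conj x ^ σ * (w * conj x)))
          ≈⟨ solve 10 (λ C D C̄ D̄ x y u v w wσ →
               C :* (w :* x) :* (wσ :* v) :+ D :* (wσ :* u :* (w :* x))
                 :+ (C̄ :* (w :* y) :* (wσ :* u) :+ D̄ :* (wσ :* v :* (w :* y)))
               := wσ :* w :* (C :* x :* v :+ D :* (u :* x) :+ (C̄ :* y :* u :+ D̄ :* (v :* y))))
             refl C₁ C₂ (conj C₁) (conj C₂) x (conj x) (x ^ σ) (conj x ^ σ) w (w ^ σ) ⟩
        w ^ σ * w * (C₁ * x * conj x ^ σ + C₂ * (x ^ σ * x)
          + (conj C₁ * conj x * x ^ σ + conj C₂ * (conj x ^ σ * conj x)))
          ≈⟨ *-congˡ (form-expand refl refl refl) ⟨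
        w ^ σ * w * form x  ∎

      -- In G(Xy) with y = x̄, the conjugate of Xy is y again, so all four terms contain y^σ y, and
      -- the cofactor is `P X`.
      form≈P : ∀ {X x} → X * conj x ≈ x → form x ≈ conj x ^ σ * conj x * P X
      form≈P {X} {x} Xy≈x = begin
        form x
          ≈⟨ form-cong Xy≈x ⟨
        form (X * y)
          ≈⟨ form-expand (conj-cong Xy≈x) (^-distrib-* X y σ) refl ⟩
        C₁ * (X * y) * y ^ σ + C₂ * (X ^ σ * y ^ σ * (X * y))
          + (conj C₁ * y * (X ^ σ * y ^ σ) + conj C₂ * (y ^ σ * y))
          ≈⟨ solve 8 (λ C D C̄ D̄ X Xσ y yσ →
               C :* (X :* y) :* yσ :+ D :* (Xσ :* yσ :* (X :* y))
                 :+ (C̄ :* y :* (Xσ :* yσ) :+ D̄ :* (yσ :* y))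
               := yσ :* y :* (D :* (Xσ :* X) :+ C̄ :* Xσ :+ C :* X :+ D̄))
             refl C₁ C₂ (conj C₁) (conj C₂) X (X ^ σ) y (y ^ σ) ⟩
        y ^ σ * y * (C₂ * (X ^ σ * X) + conj C₁ * X ^ σ + C₁ * X + conj C₂)
          ≈⟨ *-congˡ (+-congʳ (+-congʳ (+-congʳ (*-congˡ (x^[n+1]≈x^n*x X σ))))) ⟨
        y ^ σ * y * P X  ∎
        where
        y : F.Carrier
        y = conj x

      -- G(1) = T(C₁ + C₂), and the trace of v + hz is h.
      ι-p₁ : ι (h₁ L.+ h₂) ≈ form 1#
      ι-p₁ = sym (begin
        form 1#
          ≈⟨ form-expand conj-1 (FF.1^n≈1 σ) (FF.1^n≈1 σ) ⟩
        C₁ * 1# * 1# + C₂ * (1# * 1#) + (conj C₁ * 1# * 1# + conj C₂ * (1# * 1#))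
          ≈⟨ +-congˡ (+-cong (*-congʳ (*-congʳ (conj-coordinates v₁ h₁)))
                             (*-congʳ (conj-coordinates v₂ h₂))) ⟩
        (ι v₁ + ι h₁ * z) * 1# * 1# + (ι v₂ + ι h₂ * z) * (1# * 1#)
          + ((ι v₁ + ι h₁ * (z + 1#)) * 1# * 1# + (ι v₂ + ι h₂ * (z + 1#)) * (1# * 1#))
          ≈⟨ solve 5 (λ v h v′ h′ z →
               (v :+ h :* z) :* con true :* con true
                 :+ (v′ :+ h′ :* z) :* (con true :* con true)
                 :+ ((v :+ h :* (z :+ con true)) :* con true :* con true
                     :+ (v′ :+ h′ :* (z :+ con true)) :* (con true :* con true))
               := h :+ h′)
             refl (ι v₁) (ι h₁) (ι v₂) (ι h₂) z ⟩
        ι h₁ + ι h₂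
          ≈⟨ +-homo h₁ h₂ ⟨
        ι (h₁ L.+ h₂)  ∎)

      -- The origin of `quadruple`: its entries are the coefficients of w^(σ+1), w^σ, w and 1 in G(w
      -- + z).
      ι-p : ∀ w → ι (p w) ≈ form (ι w + z)
      ι-p w = begin
        ι (p w)
          ≈⟨ ι-projectivePolynomial σ w refl ⟩
        F.projectivePolynomial σ (ι _ , ι _ , ι _ , ι _) (ι w)
          ≈⟨ +-cong (+-cong (+-cong
               (*-cong (refl ⟨+⟩ refl) (x^[n+1]≈x^n*x (ι w) σ))
               (*-congʳ (refl ⟨+⟩ refl ⟨+⟩ refl ⟨+⟩ refl)))
               (*-congʳ (refl ⟨+⟩ refl ⟨+⟩ refl ⟨*⟩ refl ⟨+⟩ (refl ⟨+⟩ 1#-homo) ⟨*⟩ refl)))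
               (refl ⟨*⟩ refl ⟨+⟩ (refl ⟨+⟩ 1#-homo) ⟨*⟩ refl ⟨+⟩ (refl ⟨+⟩ ιμ≈) ⟨*⟩ refl
                 ⟨+⟩ (refl ⟨+⟩ ιμ≈ ⟨+⟩ 1#-homo) ⟨*⟩ refl) ⟩
        (ι h₁ + ι h₂) * (W * ι w) + (ι v₁ + ι v₂ + ι h₁ + ι h₂) * W
          + (ι v₁ + ι v₂ + M * ι h₁ + (M + 1#) * ι h₂) * ι w
          + (M * ι v₁ + (M + 1#) * ι v₂ + (M + (z ^ 2 + z)) * ι h₁ + (M + (z ^ 2 + z) + 1#) * ι h₂)
          ≈⟨ solve 8 (λ v h v′ h′ z w W M →
               (h :+ h′) :* (W :* w) :+ (v :+ v′ :+ h :+ h′) :* W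
                 :+ (v :+ v′ :+ M :* h :+ (M :+ con true) :* h′) :* w
                 :+ (M :* v :+ (M :+ con true) :* v′ :+ (M :+ (z :^ 2 :+ z)) :* h
                     :+ (M :+ (z :^ 2 :+ z) :+ con true) :* h′)
               := (v :+ h :* z) :* (w :+ z) :* (W :+ (z :+ M) :+ con true)
                    :+ (v′ :+ h′ :* z) :* ((W :+ (z :+ M)) :* (w :+ z))
                    :+ ((v :+ h :* (z :+ con true)) :* (w :+ (z :+ con true)) :* (W :+ (z :+ M))
                        :+ (v′ :+ h′ :* (z :+ con true))
                             :* ((W :+ (z :+ M) :+ con true) :* (w :+ (z :+ con true)))))
             refl (ι v₁) (ι h₁) (ι v₂) (ι h₂) z (ι w) W M ⟩
        C₁ * (ι w + z) * (W + (z + M) + 1#) + C₂ * ((W + (z + M)) * (ι w + z))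
          + ((ι v₁ + ι h₁ * (z + 1#)) * (ι w + (z + 1#)) * (W + (z + M))
             + (ι v₂ + ι h₂ * (z + 1#)) * ((W + (z + M) + 1#) * (ι w + (z + 1#))))
          ≈⟨ +-congˡ (+-cong (*-congʳ (*-congʳ (conj-coordinates v₁ h₁)))
                             (*-congʳ (conj-coordinates v₂ h₂))) ⟨
        C₁ * (ι w + z) * (W + (z + M) + 1#) + C₂ * ((W + (z + M)) * (ι w + z))
          + (conj C₁ * (ι w + (z + 1#)) * (W + (z + M))
             + conj C₂ * ((W + (z + M) + 1#) * (ι w + (z + 1#))))
          ≈⟨ form-expand conj-x xσ ȳσ ⟨
        form (ι w + z)  ∎
        where
        W M : F.Carrier
        W = ι w ^ σ
        M = ι (L.frobeniusSum s μ)
        -- The solver knows no relation between z and μ; writing μ as z² + z leaves an identity in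
        -- free variables.
        ιμ≈ : ι μ ≈ z ^ 2 + z
        ιμ≈ = sym z²+z≈μ
        conj-x : conj (ι w + z) ≈ ι w + (z + 1#)
        conj-x = trans (conj-+ _ _) (+-cong (conj-ι w) conj-z)
        xσ : (ι w + z) ^ σ ≈ W + (z + M)
        xσ = trans (^2ⁿ-distrib-+ s (ι w) z) (+-congˡ (Artin-Schreier-^2ˢ s z²+z≈μ))
        ȳσ : (ι w + (z + 1#)) ^ σ ≈ W + (z + M) + 1#
        ȳσ = begin
          (ι w + (z + 1#)) ^ σ  ≈⟨ ^-congˡ σ (+-assoc (ι w) z 1#) ⟨
          (ι w + z + 1#) ^ σ    ≈⟨ ^2ⁿ-distrib-+ s (ι w + z) 1# ⟩
          (ι w + z) ^ σ + 1# ^ σ ≈⟨ +-cong xσ (FF.1^n≈1 σ) ⟩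
          W + (z + M) + 1#      ∎

      presemifield : Set (c ⊔ ℓ₁)
      presemifield = IsPresemifield _≈_ _+_ _∗_ 0# (-_)

      nonvanishing : Set (c ⊔ ℓ₁)
      nonvanishing = ∀ x → x ≉ 0# → form x ≉ 0#

      noRootOfNorm1 : Set (c ⊔ ℓ₁)
      noRootOfNorm1 = ∀ X → N X ≈ 1# → P X ≉ 0#

      noRootInL : Set (c′ ⊔ ℓ₁′)
      noRootInL = NoProjectiveRootInL σ (quadruple μ s (v₁ , h₁) (v₂ , h₂))

      nonvanishing⇔noRootOfNorm1 : nonvanishing ⇔ noRootOfNorm1
      nonvanishing⇔noRootOfNorm1 = mk⇔ to from
        where
        to : nonvanishing → noRootOfNorm1
        to form≉0 X NX≈1 PX≈0 = let x , x≉0 , Xx̄≈x = hilbert90 X NX≈1 in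
          form≉0 x x≉0 (trans (form≈P Xx̄≈x) (trans (*-congˡ PX≈0) (zeroʳ _)))
        from : noRootOfNorm1 → nonvanishing
        from P≉0 x x≉0 formx≈0 = let X , NX≈1 , Xx̄≈x = norm1-quotient x≉0 in
          P≉0 X NX≈1 (x*y≈0⇒y≈0
            (x*y≉0 (FF.x^n≉0 1≉0 σ (conj-≉0 x≉0)) (conj-≉0 x≉0))
            (trans (sym (form≈P Xx̄≈x)) formx≈0))

      form-vanishes : ∀ {w x} y → conj w ≈ w → w ≉ 0# → x ≈ w * y → form x ≈ 0# → form y ≈ 0#
      form-vanishes y w̄≈w w≉0 x≈wy formx≈0 = x*y≈0⇒y≈0
        (x*y≉0 (FF.x^n≉0 1≉0 σ w≉0) w≉0)
        (trans (sym (form-homogeneous y w̄≈w)) (trans (form-cong (sym x≈wy)) formx≈0))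

      nonvanishing⇔noRootInL : nonvanishing ⇔ noRootInL
      nonvanishing⇔noRootInL = mk⇔ to from
        where
        to : nonvanishing → noRootInL
        to form≉0 =
            (λ p₁≈0 → form≉0 1# 1≉0 (trans (sym ι-p₁) (trans (ι-cong p₁≈0) 0#-homo)))
          -- The z-coordinate of w + z is 1, hence w + z is not 0.
          , (λ w pw≈0 → form≉0 (ι w + z)
               (λ w+z≈0 → 1≉0 (proj₂ (independent (conj-ι w) conj-1
                 (trans (+-congˡ (*-identityˡ z)) w+z≈0))))
               (trans (sym (ι-p w)) (trans (ι-cong pw≈0) 0#-homo)))

        -- x = a + bz is an L-multiple of 1 if b = 0, and of a/b + z otherwise.
        module _ (noRoot : noRootInL) {x} (x≉0 : x ≉ 0#) (formx≈0 : form x ≈ 0#)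
                 {a b} (x≈ : x ≈ ι a + ι b * z) where
          atInfinity : b L.≈ L.0# → ⊥
          atInfinity b≈0 = proj₁ noRoot (ι-injective (trans ι-p₁ (trans
            (form-vanishes 1# (conj-ι a) ιa≉0 (trans x≈a (sym (*-identityʳ _))) formx≈0)
            (sym 0#-homo))))
            where
            x≈a : x ≈ ι a
            x≈a = begin
              x              ≈⟨ x≈ ⟩
              ι a + ι b * z  ≈⟨ +-congˡ (*-congʳ (trans (ι-cong b≈0) 0#-homo)) ⟩
              ι a + 0# * z   ≈⟨ trans (+-congˡ (zeroˡ z)) (+-identityʳ _) ⟩
              ι a            ∎
            ιa≉0 : ι a ≉ 0#
            ιa≉0 ιa≈0 = x≉0 (trans x≈a ιa≈0)

          affine : b L.≉ L.0# → ⊥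
          affine b≉0 = proj₂ noRoot w (ι-injective (trans (ι-p w) (trans
            (form-vanishes (ι w + z) (conj-ι b) (ι-≉0 b≉0) x≈b[w+z] formx≈0)
            (sym 0#-homo))))
            where
            r = proj₁ (LF.recip b≉0)
            w = a L.* r
            x≈b[w+z] : x ≈ ι b * (ι w + z)
            x≈b[w+z] = begin
              x                            ≈⟨ x≈ ⟩
              ι a + ι b * z                ≈⟨ +-congʳ (*-identityʳ (ι a)) ⟨
              ι a * 1# + ι b * z
                ≈⟨ +-congʳ (*-congˡ (trans (ι-cong (proj₂ (LF.recip b≉0))) 1#-homo)) ⟨
              ι a * ι (b L.* r) + ι b * z  ≈⟨ +-congʳ (*-congˡ (refl ⟨*⟩ refl)) ⟩
              ι a * (ι b * ι r) + ι b * z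
                ≈⟨ solve 4 (λ a b r z → a :* (b :* r) :+ b :* z := b :* (a :* r :+ z))
                     refl (ι a) (ι b) (ι r) z ⟩
              ι b * (ι a * ι r + z)        ≈⟨ *-congˡ (+-congʳ (refl ⟨*⟩ refl)) ⟨
              ι b * (ι w + z)              ∎

        from : noRootInL → nonvanishing
        from noRoot x x≉0 formx≈0 = let a , b , x≈ = coordinates x in
          decide (b LF.≟ L.0#) x≈
          where
          decide : ∀ {a b} → Dec (b L.≈ L.0#) → x ≉ ι a + ι b * z
          decide (yes b≈0) x≈ = atInfinity noRoot x≉0 formx≈0 x≈ b≈0
          decide (no  b≉0) x≈ = affine noRoot x≉0 formx≈0 x≈ b≉0

      -- The multiplication and its zero divisors.

      A : F.Carrier → F.Carrier
      A y = C₁ * y ^ σ + C₂ * conj y ^ σ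

      A-cong : ∀ {x y} → x ≈ y → A x ≈ A y
      A-cong x≈y = +-cong (*-congˡ (^-congˡ σ x≈y)) (*-congˡ (^-congˡ σ (conj-cong x≈y)))

      A-+ : ∀ x y → A (x + y) ≈ A x + A y
      A-+ x y = begin
        A (x + y)
          ≈⟨ +-cong (*-congˡ (^2ⁿ-distrib-+ s x y))
               (*-congˡ (trans (^-congˡ σ (conj-+ x y)) (^2ⁿ-distrib-+ s (conj x) (conj y)))) ⟩
        C₁ * (x ^ σ + y ^ σ) + C₂ * (conj x ^ σ + conj y ^ σ)
          ≈⟨ solve 6 (λ C D a b c d → C :* (a :+ b) :+ D :* (c :+ d)
               := C :* a :+ D :* c :+ (C :* b :+ D :* d)) refl C₁ C₂ _ _ _ _ ⟩
        A x + A y  ∎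

      -- Two symmetric hypotheses cover both uses: y given as x̄, and x given as ȳ.
      T[Ay*x]≈form : ∀ {x y} → conj x ≈ y → conj y ≈ x → T (A y * x) ≈ form x
      T[Ay*x]≈form {x} {y} x̄≈y ȳ≈x = T-cong (begin
        (C₁ * y ^ σ + C₂ * conj y ^ σ) * x
          ≈⟨ *-congʳ (+-cong (*-congˡ (^-congˡ σ (sym x̄≈y))) (*-congˡ (^-congˡ σ ȳ≈x))) ⟩
        (C₁ * conj x ^ σ + C₂ * x ^ σ) * x
          ≈⟨ solve 5 (λ C D x u v → (C :* v :+ D :* u) :* x := C :* x :* v :+ D :* (u :* x))
               refl C₁ C₂ x (x ^ σ) (conj x ^ σ) ⟩
        C₁ * x * conj x ^ σ + C₂ * (x ^ σ * x)
          ≈⟨ +-congˡ (*-congˡ (x^[n+1]≈x^n*x x σ)) ⟨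
        C₁ * x * conj x ^ σ + C₂ * x ^ (σ ℕ.+ 1)  ∎)

      -- The z-coordinate is T(N(x)), which is N(x) added to itself.
      x∗x̄≈form : ∀ x → x ∗ conj x ≈ form x
      x∗x̄≈form x = begin
        T (A (conj x) * x) + T (N x) * z
          ≈⟨ +-cong (T[Ay*x]≈form refl (conj-involutive x)) (*-congʳ TN≈0) ⟩
        form x + 0# * z                   ≈⟨ trans (+-congˡ (zeroˡ z)) (+-identityʳ _) ⟩
        form x                            ∎
        where
        TN≈0 : T (N x) ≈ 0#
        TN≈0 = begin
          N x + conj (x * conj x)
            ≈⟨ +-congˡ (trans (conj-* x (conj x))
                 (trans (*-congˡ (conj-involutive x)) (*-comm _ _))) ⟩
          N x + N x                ≈⟨ x+x≈0 (N x) ⟩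
          0#                       ∎

      ∗-cong : ∀ {x x′ y y′} → x ≈ x′ → y ≈ y′ → x ∗ y ≈ x′ ∗ y′
      ∗-cong x≈x′ y≈y′ = +-cong (T-cong (*-cong (A-cong y≈y′) x≈x′))
                                (*-congʳ (T-cong (*-cong x≈x′ y≈y′)))

      ∗-distribˡ : ∀ x y w → x ∗ (y + w) ≈ x ∗ y + x ∗ w
      ∗-distribˡ x y w = begin
        T (A (y + w) * x) + T (x * (y + w)) * z
          ≈⟨ +-cong (trans (T-cong (trans (*-congʳ (A-+ y w)) (distribʳ x (A y) (A w)))) (T-+ _ _))
                    (*-congʳ (trans (T-cong (distribˡ x y w)) (T-+ _ _))) ⟩
        T (A y * x) + T (A w * x) + (T (x * y) + T (x * w)) * z
          ≈⟨ solve 5 (λ a b c d z → a :+ b :+ (c :+ d) :* z := a :+ c :* z :+ (b :+ d :* z))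
               refl _ _ _ _ z ⟩
        x ∗ y + x ∗ w  ∎

      ∗-distribʳ : ∀ x y w → (y + w) ∗ x ≈ y ∗ x + w ∗ x
      ∗-distribʳ x y w = begin
        T (A x * (y + w)) + T ((y + w) * x) * z
          ≈⟨ +-cong (trans (T-cong (distribˡ (A x) y w)) (T-+ _ _))
                    (*-congʳ (trans (T-cong (distribʳ x y w)) (T-+ _ _))) ⟩
        T (A x * y) + T (A x * w) + (T (y * x) + T (w * x)) * z
          ≈⟨ solve 5 (λ a b c d z → a :+ b :+ (c :+ d) :* z := a :+ c :* z :+ (b :+ d :* z))
               refl _ _ _ _ z ⟩
        y ∗ x + w ∗ x  ∎

      -- T(xy) = 0 forces w = x/ȳ into L, and then T(A(y) x) = w · form ȳ.
      module _ (form≉0 : nonvanishing) {x y} (x≉0 : x ≉ 0#) (y≉0 : y ≉ 0#) where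
        ȳ w : F.Carrier
        ȳ = conj y
        w = x * proj₁ (recip (conj-≉0 y≉0))

        x≈wȳ : x ≈ w * ȳ
        x≈wȳ = begin
          x               ≈⟨ *-identityʳ x ⟨
          x * 1#          ≈⟨ *-congˡ (proj₂ (recip (conj-≉0 y≉0))) ⟨
          x * (ȳ * proj₁ (recip (conj-≉0 y≉0)))
            ≈⟨ solve 3 (λ x ȳ r → x :* (ȳ :* r) := x :* r :* ȳ) refl x ȳ _ ⟩
          w * ȳ           ∎

        w≉0 : w ≉ 0#
        w≉0 w≈0 = x≉0 (trans x≈wȳ (trans (*-congʳ w≈0) (zeroˡ ȳ)))

        conj-w : T (x * y) ≈ 0# → conj w ≈ w
        -- With x = wȳ one has T(xy) = N(y) T(w), and N(y) is not 0.
        conj-w Txy≈0 = sym (x+y≈0⇒x≈y (x*y≈0⇒y≈0 (x*y≉0 (conj-≉0 y≉0) y≉0) (begin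
          ȳ * y * (w + conj w)
            ≈⟨ solve 4 (λ y ȳ w w̄ → ȳ :* y :* (w :+ w̄) := w :* ȳ :* y :+ w̄ :* y :* ȳ)
                 refl y ȳ w (conj w) ⟩
          w * ȳ * y + conj w * y * ȳ
            ≈⟨ +-cong (*-congʳ x≈wȳ) (*-congʳ (trans (trans (conj-cong x≈wȳ) (conj-* w ȳ))
                 (*-congˡ (conj-involutive y)))) ⟨
          x * y + conj x * ȳ
            ≈⟨ +-congˡ (conj-* x y) ⟨
          T (x * y)
            ≈⟨ Txy≈0 ⟩
          0#  ∎)))

        x∗y≉0 : x ∗ y ≉ 0#
        x∗y≉0 x∗y≈0 = form≉0 ȳ (conj-≉0 y≉0) (x*y≈0⇒y≈0 w≉0 (begin
          w * form ȳ          ≈⟨ *-congˡ (T[Ay*x]≈form (conj-involutive y) refl) ⟨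
          w * T (A y * ȳ)     ≈⟨ T-homogeneous (conj-w (proj₂ parts≈0)) (A y * ȳ) ⟨
          T (w * (A y * ȳ))
            ≈⟨ T-cong (solve 3 (λ w a ȳ → w :* (a :* ȳ) := a :* (w :* ȳ)) refl w (A y) ȳ) ⟩
          T (A y * (w * ȳ))   ≈⟨ T-cong (*-congˡ x≈wȳ) ⟨
          T (A y * x)         ≈⟨ proj₁ parts≈0 ⟩
          0#                  ∎))
          where
          -- Both coordinates of the product are traces, hence fixed by `conj`, so `independent`
          -- separates them.
          parts≈0 : T (A y * x) ≈ 0# × T (x * y) ≈ 0#
          parts≈0 = independent (conj-T _) (conj-T _) x∗y≈0

      presemifield⇔nonvanishing : presemifield ⇔ nonvanishing
      presemifield⇔nonvanishing = mk⇔ to from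
        where
        to : presemifield → nonvanishing
        to S x x≉0 formx≈0 =
          [ x≉0 , conj-≉0 x≉0 ]′
            (IsPresemifield.noZeroDivisors S x (conj x) (trans (x∗x̄≈form x) formx≈0))
        from : nonvanishing → presemifield
        from form≉0 = record
          { +-isAbelianGroup = +-isAbelianGroup
          ; finite           = 2 ℕ.^ (2 ℕ.* m) , F.order
          ; ∙-cong           = ∗-cong
          ; distrib          = ∗-distribˡ , ∗-distribʳ
          ; noZeroDivisors   = λ x y x∗y≈0 → decide (x ≟ 0#) (y ≟ 0#) x∗y≈0
          }
          where
          decide : ∀ {x y} → Dec (x ≈ 0#) → Dec (y ≈ 0#) → x ∗ y ≈ 0# → (x ≈ 0#) ⊎ (y ≈ 0#)
          decide (yes x≈0) _         _     = inj₁ x≈0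
          decide (no _)    (yes y≈0) _     = inj₂ y≈0
          decide (no x≉0)  (no y≉0)  x∗y≈0 = contradiction x∗y≈0 (x∗y≉0 form≉0 x≉0 y≉0)

theorem2 :
  ∀ {c ℓ₁ ℓ₂ c′ ℓ₁′ ℓ₂′ : Level}
  (m : ℕ) → 1 ≤ m →
  (E : QuadraticExtension m c ℓ₁ ℓ₂ c′ ℓ₁′ ℓ₂′) →
  let open QuadraticExtension E
      open F
  in
  (μ : L.Carrier) → L.frobeniusSum m μ L.≈ L.1# →
  (z : F.Carrier) → z ^ 2 + z ≈ ι μ →
  (s : ℕ) → s < 2 ℕ.* m →
  (v₁ h₁ v₂ h₂ : L.Carrier) →
  let σ  = 2 ℕ.^ s
      C₁ = fromCoordinates z (v₁ , h₁)
      C₂ = fromCoordinates z (v₂ , h₂)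
      t  = quadruple μ s (v₁ , h₁) (v₂ , h₂)

      presemifield = IsPresemifield _≈_ _+_ (product z σ C₁ C₂) 0# (-_)


      nonvanishing : Set (c ⊔ ℓ₁)
      nonvanishing = ∀ x → x ≉ 0# →
        T (C₁ * x * conj x ^ σ + C₂ * x ^ (σ ℕ.+ 1)) ≉ 0#


      noRootOfNorm1 : Set (c ⊔ ℓ₁)
      noRootOfNorm1 = ∀ X → N X ≈ 1# →
        F.projectivePolynomial σ (C₂ , conj C₁ , C₁ , conj C₂) X ≉ 0#

      noRootInL = NoProjectiveRootInL σ t
  in
  (presemifield ⇔ nonvanishing)
    × (nonvanishing ⇔ noRootOfNorm1)
    × (noRootOfNorm1 ⇔ noRootInL)
theorem2 m 1≤m E μ trace z z²+z≈μ s _ v₁ h₁ v₂ h₂ =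
    presemifield⇔nonvanishing
  , nonvanishing⇔noRootOfNorm1
  , nonvanishing⇔noRootInL ⇔-∘ Symmetry.⇔-sym nonvanishing⇔noRootOfNorm1
  where
  open Extension 1≤m E
  open Semifield μ trace z z²+z≈μ s v₁ h₁ v₂ h₂
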